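{- Let $\mathsf{L}$ be a logic. A continuous and truthful censor satisfies at most two of the three properties: effective, minimally invasive, repudiating. That is, there is no censor that is simultaneously continuous, truthful, effective, minimally invasive, and repudiating.
   Context: Logic. A logic $\mathsf{L}$ is a set of formulas $\mathsf{Fml}_{\mathsf L}$ with a relation $\vdash_{\mathsf L}\subseteq \mathcal P(\mathsf{Fml}_{\mathsf L})\times \mathsf{Fml}_{\mathsf L}$ such that for all formulas $A,C$ and all sets of formulas $\Gamma,\Delta$: (reflexivity) $\{A\}\vdash_{\mathsf L}A$; (weakening) $\Gamma\vdash_{\mathsf L}A$ implies $\Gamma\cup\Delta\vdash_{\mathsf L}A$; (transitivity) $\Gamma\vdash_{\mathsf L}C$ and $\Delta\cup\{C\}\vdash_{\mathsf L}A$ imply $\Gamma\cup\Delta\vdash_{\mathsf L}A$. A set $\Gamma$ is $\mathsf L$-consistent if $\Gamma\not\vdash_{\mathsf L}A$ for some formula $A$. The logic $\mathsf L$ is not specified any further. Modal logic $\mathsf M$ over $\mathsf L$. The set $\mathsf{Fml}_{\mathsf M}$ is generated by: $\Box A$ for $A\in\mathsf{Fml}_{\mathsf L}$; $\bot$; $A\to B$ for $A,B\in\mathsf{Fml}_{\mathsf M}$. The connectives $\top,\neg,\land,\lor$ are defined classically from these. An $\mathsf M$-model is any set $\mathcal M\subseteq\mathcal P(\mathsf{Fml}_{\mathsf L})$. Truth: $\mathcal M\Vdash\Box A$ iff $w\vdash_{\mathsf L}A$ for all $w\in\mathcal M$; $\mathcal M\not\Vdash\bot$; $\mathcal M\Vdash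 A\to B$ iff $\mathcal M\not\Vdash A$ or $\mathcal M\Vdash B$. For $\Gamma\subseteq\mathsf{Fml}_{\mathsf M}$: $\mathcal M\Vdash\Gamma$ iff $\mathcal M\Vdash A$ for all $A\in\Gamma$; $\Gamma$ is satisfiable iff $\mathcal M\Vdash\Gamma$ for some $\mathsf M$-model $\mathcal M$; $\Gamma\models A$ iff every $\mathsf M$-model $\mathcal M$ with $\mathcal M\Vdash\Gamma$ has $\mathcal M\Vdash A$. Privacy configuration. A triple $(\mathsf{KB},\mathsf{AK},\mathsf{Sec})$ with $\mathsf{KB}\subseteq\mathsf{Fml}_{\mathsf L}$, $\mathsf{AK}\subseteq\mathsf{Fml}_{\mathsf M}$, $\mathsf{Sec}\subseteq\mathsf{Fml}_{\mathsf L}$ such that $\mathsf{KB}$ is $\mathsf L$-consistent, $\{\mathsf{KB}\}\Vdash\mathsf{AK}$ (the one-element model $\{\mathsf{KB}\}$), and $\mathsf{AK}\not\models\Box s$ for each $s\in\mathsf{Sec}$. Evaluation and censors. $\mathsf{eval}(\mathsf{KB},q)=t$ if $\mathsf{KB}\vdash_{\mathsf L}q$, and $=u$ otherwise. The answer set is $\mathbb A=\{t,u,r\}$ (three distinct values; $r$ means refusal). $X^\omega$ is the set of infinite sequences $(s_1,s_2,\dots)$ over $X$; $s|_n=(s_1,\dots,s_n)$. A censor $\mathsf{Cens}$ assigns to each privacy configuration a function $\mathsf{Cens}_{(\mathsf{KB},\mathsf{AK},\mathsf{Sec})}:\mathsf{Fml}_{\mathsf L}^\omega\to\mathbb A^\omega$.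 Elements of $\mathsf{Fml}_{\mathsf L}^\omega$ are called query sequences. Content. $\mathsf{cont}(q,t)=\Box q$, $\mathsf{cont}(q,u)=\neg\Box q$, $\mathsf{cont}(q,r)=\top$; and for a query sequence $q$ with answers $a=\mathsf{Cens}_{(\mathsf{KB},\mathsf{AK},\mathsf{Sec})}(q)$, $\mathsf{cont}(\mathsf{Cens}_{(\mathsf{KB},\mathsf{AK},\mathsf{Sec})}(q),n)=\{\mathsf{cont}(q_i,a_i):1\le i\le n\}\cup\mathsf{AK}$. Properties of a censor $\mathsf{Cens}$ (below, $\mathsf{Cens}_P$ denotes the answering function at the privacy configuration $P=(\mathsf{KB},\mathsf{AK},\mathsf{Sec})$). - Continuous: for each $P$, all query sequences $q,q'$ and all $n$, $q|_n=q'|_n$ implies $\mathsf{Cens}_P(q)|_n=\mathsf{Cens}_P(q')|_n$. - Truthful: for each $P$, each query sequence $q$ and each $i\geq 1$, $\mathsf{Cens}_P(q)_i\in\{\mathsf{eval}(\mathsf{KB},q_i),r\}$. - Credible: for each $P$, $q$, $n$, the set $\mathsf{cont}(\mathsf{Cens}_P(q),n)$ is satisfiable. - Effective: for each $P$, $q$, $n$ and each $s\in\mathsf{Sec}$, $\mathsf{cont}(\mathsf{Cens}_P(q),n)\not\models\Box s$. - Minimally invasive: $\mathsf{Cens}$ is effective and credible, and for each $P$, each $q$ and each $i\ge1$ with $\mathsf{Cens}_P(q)_i\ne\mathsf{eval}(\mathsf{KB},q_i)$, the following holds: for any censor $\mathsf{Cens}'$ with $\mathsf{Cens}'_P(q)|_{i-1}=\mathsf{Cens}_P(q)|_{i-1}$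 and $\mathsf{Cens}'_P(q)_i=\mathsf{eval}(\mathsf{KB},q_i)$ there is an $n$ such that $\mathsf{cont}(\mathsf{Cens}'_P(q),n)\models\Box s$ for some $s\in\mathsf{Sec}$, or $\mathsf{cont}(\mathsf{Cens}'_P(q),n)$ is not satisfiable. - Repudiating: for each $P$ and each query sequence $q$ there are knowledge bases $\mathsf{KB}_i\subseteq \mathsf{Fml}_{\mathsf L}$ ($i\in\omega$) such that (1) $(\mathsf{KB}_i,\mathsf{AK},\mathsf{Sec})$ is a privacy configuration for each $i\in\omega$; (2) $\mathsf{Cens}_{(\mathsf{KB},\mathsf{AK},\mathsf{Sec})}(q)|_n=\mathsf{Cens}_{(\mathsf{KB}_n,\mathsf{AK},\mathsf{Sec})}(q)|_n$ for each $n\in\omega$; (3) $\mathsf{KB}_i\not\vdash_{\mathsf L}s$ for each $s\in\mathsf{Sec}$ and each $i\in\omega$.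
   Formalization: The logic is additionally assumed to have a formula s that is not derivable from the empty set and such that {s} is consistent; in a logic without such a formula the claim is false, since the censor that always answers with the evaluation has all five properties. -}

module Defs where

open import Data.Empty.Polymorphic using (⊥)
open import Data.Fin using (toℕ)
open import Data.Nat using (ℕ; _<_)
open import Data.Product using (∃-syntax; Σ-syntax; _×_)
open import Data.Sum using (_⊎_)
open import Data.Vec using (Vec; tabulate)
open import Function using (_∘_)
open import Level using (Level; suc; _⊔_)
open import Relation.Binary.PropositionalEquality using (_≡_; _≗_)
open import Relation.Nullary using (¬_)
open import Relation.Unary using (Pred; _∈_; _∪_; _≐_; ｛_｝)

private
  variable
    a : Level

-- Subsets are predicates, so sets with the same elements need not be equal
-- in the sense of _≡_; ⊢-resp-≐ makes ⊢ a relation on sets.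
record Logic (ℓ ρ : Level) : Set (suc (ℓ ⊔ ρ)) where
  infix 4 _⊢_ _⊬_
  field
    Fml        : Set ℓ
    _⊢_        : Pred Fml ℓ → Fml → Set ρ
    ⊢-resp-≐   : ∀ {Γ Δ : Pred Fml ℓ} {A} → Γ ≐ Δ → Γ ⊢ A → Δ ⊢ A
    reflexive  : ∀ A → ｛ A ｝ ⊢ A
    weakening  : ∀ (Γ Δ : Pred Fml ℓ) A → Γ ⊢ A → Γ ∪ Δ ⊢ A
    transitive : ∀ (Γ Δ : Pred Fml ℓ) A C → Γ ⊢ C → Δ ∪ ｛ C ｝ ⊢ A → Γ ∪ Δ ⊢ A

  _⊬_ : Pred Fml ℓ → Fml → Set ρ
  Γ ⊬ A = ¬ (Γ ⊢ A)

  Consistent : Pred Fml ℓ → Set (ℓ ⊔ ρ)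
  Consistent Γ = ∃[ A ] Γ ⊬ A

  -- Neither a theorem nor inconsistent.  In a logic without contingent
  -- formulas no knowledge base of a privacy configuration derives a secret, so
  -- (classically) the censor that always answers with the evaluation has every
  -- property defined below.
  Contingent : Fml → Set (ℓ ⊔ ρ)
  Contingent A = (λ _ → ⊥) ⊬ A × Consistent ｛ A ｝

data Answer : Set where
  t u r : Answer

-- Sequences are indexed from 0, so s i is the (i + 1)-st entry.
_^ω : Set a → Set a
X ^ω = ℕ → X

infixl 7 _↾_
_↾_ : {X : Set a} → X ^ω → (n : ℕ) → Vec X n
s ↾ n = tabulate {n = n} (s ∘ toℕ)

module Privacy {ℓ ρ : Level} (L : Logic ℓ ρ) where
  open Logic L

  infixr 6 _⇒_
  data MFml : Set ℓ where
    □_  : Fml → MFml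
    ⊥ᴹ  : MFml
    _⇒_ : MFml → MFml → MFml

  ¬ᴹ_ : MFml → MFml
  ¬ᴹ A = A ⇒ ⊥ᴹ

  ⊤ᴹ : MFml
  ⊤ᴹ = ¬ᴹ ⊥ᴹ

  Model : Set (suc (suc ℓ))
  Model = Pred (Pred Fml ℓ) (suc ℓ)

  infix 4 _⊩_ _⊩ˢ_ _⊨_ _⊭_

  _⊩_ : Model → MFml → Set (suc ℓ ⊔ ρ)
  M ⊩ □ A     = ∀ w → w ∈ M → w ⊢ A
  M ⊩ ⊥ᴹ      = ⊥
  M ⊩ (A ⇒ B) = ¬ (M ⊩ A) ⊎ M ⊩ B

  _⊩ˢ_ : Model → Pred MFml ℓ → Set (suc ℓ ⊔ ρ)
  M ⊩ˢ Γ = ∀ A → A ∈ Γ → M ⊩ A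

  Satisfiable : Pred MFml ℓ → Set (suc (suc ℓ) ⊔ ρ)
  Satisfiable Γ = ∃[ M ] M ⊩ˢ Γ

  _⊨_ : Pred MFml ℓ → MFml → Set (suc (suc ℓ) ⊔ ρ)
  Γ ⊨ A = ∀ M → M ⊩ˢ Γ → M ⊩ A

  _⊭_ : Pred MFml ℓ → MFml → Set (suc (suc ℓ) ⊔ ρ)
  Γ ⊭ A = ¬ (Γ ⊨ A)

  record IsPrivacyConfiguration
      (KB : Pred Fml ℓ) (AK : Pred MFml ℓ) (Sec : Pred Fml ℓ)
      : Set (suc (suc ℓ) ⊔ ρ) where
    field
      KB-consistent : Consistent KB
      AK-true       : ｛ KB ｝ ⊩ˢ AK
      Sec-unknown   : ∀ s → s ∈ Sec → AK ⊭ □ s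

  record PrivacyConfiguration : Set (suc (suc ℓ) ⊔ ρ) where
    constructor mkPC
    field
      KB  : Pred Fml ℓ
      AK  : Pred MFml ℓ
      Sec : Pred Fml ℓ
      isPrivacyConfiguration : IsPrivacyConfiguration KB AK Sec

  open PrivacyConfiguration public

  infix 4 _≈_
  _≈_ : PrivacyConfiguration → PrivacyConfiguration → Set ℓ
  P ≈ Q = KB P ≐ KB Q × AK P ≐ AK Q × Sec P ≐ Sec Q

  -- The graph of eval: since ⊢ need not be decidable, eval(K , q) = a is
  -- expressed as Eval K q a.
  data Eval (K : Pred Fml ℓ) (q : Fml) : Answer → Set ρ where
    eval-t : K ⊢ q → Eval K q t
    eval-u : K ⊬ q → Eval K q u

  -- cong: the answers depend only on the triple, as a triple of sets, and on
  -- the entries of the query sequence.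
  record Censor : Set (suc (suc ℓ) ⊔ ρ) where
    field
      answers : PrivacyConfiguration → Fml ^ω → Answer ^ω
      cong    : ∀ {P Q q q′} → P ≈ Q → q ≗ q′ → answers P q ≗ answers Q q′

  open Censor public using (answers)

  content : Fml → Answer → MFml
  content q t = □ q
  content q u = ¬ᴹ (□ q)
  content q r = ⊤ᴹ

  cont : Censor → PrivacyConfiguration → Fml ^ω → ℕ → Pred MFml ℓ
  cont Cens P q n =
    (λ A → ∃[ i ] (i < n × A ≡ content (q i) (answers Cens P q i))) ∪ AK P

  Continuous : Censor → Set (suc (suc ℓ) ⊔ ρ)
  Continuous Cens = ∀ P q q′ n →
    q ↾ n ≡ q′ ↾ n → answers Cens P q ↾ n ≡ answers Cens P q′ ↾ n

  Truthful : Censor → Set (suc (suc ℓ) ⊔ ρ)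
  Truthful Cens = ∀ P q i →
    Eval (KB P) (q i) (answers Cens P q i) ⊎ answers Cens P q i ≡ r

  Credible : Censor → Set (suc (suc ℓ) ⊔ ρ)
  Credible Cens = ∀ P q n → Satisfiable (cont Cens P q n)

  Effective : Censor → Set (suc (suc ℓ) ⊔ ρ)
  Effective Cens = ∀ P q n s → s ∈ Sec P → cont Cens P q n ⊭ □ s

  MinimallyInvasive : Censor → Set (suc (suc ℓ) ⊔ ρ)
  MinimallyInvasive Cens = Effective Cens × Credible Cens ×
    (∀ P q i → ¬ Eval (KB P) (q i) (answers Cens P q i) →
     ∀ (Cens′ : Censor) →
     answers Cens′ P q ↾ i ≡ answers Cens P q ↾ i →
     Eval (KB P) (q i) (answers Cens′ P q i) →
     ∃[ n ] ((∃[ s ] (s ∈ Sec P × cont Cens′ P q n ⊨ □ s))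
             ⊎ ¬ Satisfiable (cont Cens′ P q n)))

  Repudiating : Censor → Set (suc (suc ℓ) ⊔ ρ)
  Repudiating Cens = ∀ P q →
    Σ[ K ∈ (ℕ → Pred Fml ℓ) ]
    Σ[ isPC ∈ (∀ i → IsPrivacyConfiguration (K i) (AK P) (Sec P)) ]
      ((∀ n → answers Cens P q ↾ n
              ≡ answers Cens (mkPC (K n) (AK P) (Sec P) (isPC n)) q ↾ n)
       × (∀ i s → s ∈ Sec P → K i ⊬ s))

{-# OPTIONS --safe #-}

-- Let s be the contingent formula and ask only for s, against KB = {s},
-- AK = ∅, Sec = {s}.  The true answer t reveals the secret, so truthfulness
-- and effectiveness force the refusal r.  Repudiation yields K ⊬ s for which s
-- is refused as well; but there the true answer u (given throughout) reveals
-- nothing, as the model {K} witnesses, so that refusal contradicts minimal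
-- invasiveness.
module Submission where

open import Defs
open import Data.Empty.Polymorphic using (⊥)
open import Data.Nat using (suc)
open import Data.Nat.Properties using (≤-refl)
open import Data.Product using (∃; _×_; _,_)
open import Data.Sum using (inj₁; inj₂)
open import Data.Vec using (head)
open import Function using (const)
open import Level using (Level)
open import Relation.Binary.PropositionalEquality
  using (_≡_; refl; sym; trans; cong; subst)
open import Relation.Nullary using (¬_)
open import Relation.Unary using (Pred; _∈_; ｛_｝)

module _ {ℓ ρ : Level} (L : Logic ℓ ρ) where
  open Logic L
  open Privacy L

  private
    ∅ : ∀ {a} {A : Set a} → Pred A ℓ
    ∅ _ = ⊥

  ⊩□-singleton : ∀ {K A} → ｛ K ｝ ⊩ □ A → K ⊢ A
  ⊩□-singleton ⊩A = ⊩A _ refl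

  secretKnown : ∀ {s} → Contingent s → PrivacyConfiguration
  secretKnown {s} (∅⊬s , s-consistent) = mkPC ｛ s ｝ ∅ ｛ s ｝ record
    { KB-consistent = s-consistent
    ; AK-true       = λ _ ()
    -- The model whose only world is `∅` satisfies the empty `AK` but not `□ s`, as `s` is no
    -- theorem.
    ; Sec-unknown   = λ { _ refl ∅⊨□s →
        ∅⊬s (⊩□-singleton (∅⊨□s ｛ ∅ ｝ λ _ ())) }
    }

  answer-t-reveals : ∀ Cens P q {i} → answers Cens P q i ≡ t →
    cont Cens P q (suc i) ⊨ □ (q i)
  answer-t-reveals Cens P q {i} a≡t M M⊩ =
    subst (λ a → M ⊩ content (q i) a) a≡t
      (M⊩ _ (inj₁ (i , ≤-refl , refl)))

  known-secret-refused : ∀ Cens → Truthful Cens → Effective Cens →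
    ∀ P q i → q i ∈ Sec P → KB P ⊢ q i → answers Cens P q i ≡ r
  known-secret-refused Cens truthful effective P q i qi∈Sec ⊢qi
    with answers Cens P q i in eq | truthful P q i
  ... | _ | inj₂ a≡r           = a≡r
  ... | _ | inj₁ (eval-u ⊬qi)  with () ← ⊬qi ⊢qi
  ... | _ | inj₁ (eval-t _)
    with () ← effective P q _ _ qi∈Sec (answer-t-reveals Cens P q eq)

  -- The rival for minimal invasiveness. It may lie elsewhere: only its answers at the configuration
  -- and query sequence in question matter.
  alwaysUnknown : Censor
  alwaysUnknown = record { answers = λ _ _ _ → u ; cong = λ _ _ _ → refl }

  -- One model serves every `n`, so if `KB P` derives no secret, both outcomes of minimal
  -- invasiveness are excluded.
  alwaysUnknown-true : ∀ P q → (∀ i → KB P ⊬ q i) →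
    ∀ n → ｛ KB P ｝ ⊩ˢ cont alwaysUnknown P q n
  alwaysUnknown-true P q ⊬q n _ (inj₁ (i , _ , refl)) =
    inj₁ λ ⊩□ → ⊬q i (⊩□-singleton ⊩□)
  alwaysUnknown-true P q ⊬q n A (inj₂ A∈AK) =
    IsPrivacyConfiguration.AK-true (isPrivacyConfiguration P) A A∈AK

  underivable-first-not-refused : ∀ Cens → MinimallyInvasive Cens → ∀ P q →
    (∀ s → s ∈ Sec P → KB P ⊬ s) → (∀ i → KB P ⊬ q i) →
    ¬ (answers Cens P q 0 ≡ r)
  underivable-first-not-refused Cens (_ , _ , minimal) P q ⊬Sec ⊬q a≡r
    -- At position 0 there are no earlier answers to agree on, hence `refl`.
    with minimal P q 0 r-not-eval alwaysUnknown refl (eval-u (⊬q 0))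
    where
    r-not-eval : ¬ Eval (KB P) (q 0) (answers Cens P q 0)
    r-not-eval e with () ← subst (Eval (KB P) (q 0)) a≡r e
  ... | n , inj₁ (s , s∈Sec , reveals) =
    ⊬Sec s s∈Sec (⊩□-singleton (reveals _ (alwaysUnknown-true P q ⊬q n)))
  ... | n , inj₂ unsatisfiable =
    unsatisfiable (_ , alwaysUnknown-true P q ⊬q n)

theorem25 : ∀ {ℓ ρ} (L : Logic ℓ ρ) → ∃ (Logic.Contingent L) →
    let open Privacy L in
    (Cens : Censor) → Continuous Cens → Truthful Cens →
    ¬ (Effective Cens × MinimallyInvasive Cens × Repudiating Cens)
theorem25 L (s , s-contingent) Cens _ truthful
  (effective , minimal , repudiating)
  with repudiating (secretKnown L s-contingent) (const s)
... | K , isPC , same , K⊬Sec =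
  underivable-first-not-refused L Cens minimal
    -- `K 1`, because the prefix of length 1 is the shortest that contains the answer at position 0.
    (mkPC (K 1) _ _ (isPC 1)) (const s) (K⊬Sec 1) (λ _ → K⊬Sec 1 s refl)
    (trans (sym (cong head (same 1)))
      (known-secret-refused L Cens truthful effective
        (secretKnown L s-contingent) (const s) 0 refl (reflexive s)))
  where
  open Logic L using (reflexive)
  open Privacy L using (mkPC)
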